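{- Let $V=\{\text{marked},\text{unmarked}\}$ with the crossing operation $x\mapsto \bar{x}$ that interchanges the two values. On the set $V^4$ of 4-tuples, define the operators $$I(a,b,c,d)=(\bar{b},\,a,\,d,\,\bar{c}),\qquad J(a,b,c,d)=(\bar{c},\,\bar{d},\,a,\,b),\qquad K(a,b,c,d)=(\bar{d},\,c,\,\bar{b},\,a).$$ Then, under composition, $I$, $J$ and $K$ generate an 8-element group of operators on $V^4$ that is isomorphic to the quaternion group $Q_8=\{\pm1,\pm i,\pm j,\pm k\}$.
   Context: In Laws of Form (LoF) an expression takes one of two values, marked or unmarked; crossing $x\mapsto\bar{x}$ (written in LoF by enclosing $x$ in the mark) swaps them, so $\bar{\bar{x}}=x$. Equality of LoF expressions means equality for all values of the variables. The Q-Calculus is the 16-valued system whose values are the 4-tuples $(a,b,c,d)\in V^4$. The operators $I,J,K$ are the "imaginary marks" of the paper with subscripts $i,j,k$. Composition of operators corresponds to nesting of marks ("containment"): enclosing $X$ in the $i$-mark and the result in the $j$-mark means applying $I$ first, then $J$; the product $ij$ corresponds to applying $I$ first and then $J$. $Q_8$ is the usual multiplicative group with $i^2=j^2=k^2=ijk=-1$. -}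

module Defs where

open import Algebra.Bundles using (Group)
open import Algebra.Morphism.Structures using (module GroupMorphisms)
open import Data.Fin.Base using (Fin; zero; suc)
open import Data.Fin.Properties using (all?; _≟_)
open import Data.List.Base using ([]; _∷_)
open import Data.List.Membership.Propositional using (_∈_)
open import Data.Product.Base using (Σ; ∃; _×_; _,_; proj₁; proj₂)
open import Data.Sign.Base as Sign using (Sign)
import Data.Sign.Properties as Sign
open import Function.Base using (_on_)
open import Function.Bundles using (Inverse; _↔_; mk↔ₛ′)
open import Function.Properties.Inverse using (↔-refl; ↔-sym; ↔-trans)
open import Level using (Level; _⊔_; 0ℓ)
open import Relation.Binary.PropositionalEquality
  using (_≡_; refl; sym; trans; cong; cong₂; isEquivalence; module ≡-Reasoning)
import Algebra.Solver.CommutativeMonoid Sign.*-commutativeMonoid as Solver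
import Relation.Binary.Construct.On as On
open import Relation.Nullary.Decidable using (from-yes; _×-dec_)
open import Relation.Unary using (Pred)

private
  variable
    a c ℓ c′ ℓ′ p : Level

-- The group of all permutations of A, with pointwise equality.  Products are
-- read from left to right: in  f ∙ g  the permutation f is applied first.
-- (Reading them the other way would make I ∙ J equal to the inverse of K.)
Sym : Set a → Group a a
Sym A = record
  { Carrier = A ↔ A
  ; _≈_     = λ f g → ∀ x → to f x ≡ to g x
  ; _∙_     = ↔-trans
  ; ε       = ↔-refl
  ; _⁻¹     = ↔-sym
  ; isGroup = record
    { isMonoid = record
      { isSemigroup = record
        { isMagma = record
          { isEquivalence = record
            { refl  = λ _ → refl
            ; sym   = λ f≈g x → sym (f≈g x)
            ; trans = λ f≈g g≈h x → trans (f≈g x) (g≈h x)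
            }
          ; ∙-cong = λ {f} {f′} {g} {g′} f≈f′ g≈g′ x →
              trans (cong (to g) (f≈f′ x)) (g≈g′ (to f′ x))
          }
        ; assoc = λ _ _ _ _ → refl
        }
      ; identity = (λ _ _ → refl) , (λ _ _ → refl)
      }
    ; inverse = strictlyInverseˡ , strictlyInverseʳ
    ; ⁻¹-cong = λ {f} {g} f≈g x → begin
        from f x                    ≡⟨ cong (from f) (strictlyInverseˡ g x) ⟨
        from f (to g (from g x))    ≡⟨ cong (from f) (f≈g (from g x)) ⟨
        from f (to f (from g x))    ≡⟨ strictlyInverseʳ f (from g x) ⟩
        from g x                    ∎
    }
  }
  where
  open Inverse
  open ≡-Reasoning

module _ (G : Group c ℓ) where

  open Group G renaming (refl to ≈-refl)

  data Generated (S : Pred Carrier p) : Pred Carrier (c ⊔ ℓ ⊔ p) where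
    gen  : ∀ {x} → S x → Generated S x
    unit : Generated S ε
    mult : ∀ {x y} → Generated S x → Generated S y → Generated S (x ∙ y)
    inv  : ∀ {x} → Generated S x → Generated S (x ⁻¹)
    resp : ∀ {x y} → x ≈ y → Generated S x → Generated S y

  -- Equality of elements ignores the membership proofs.
  generatedSubgroup : Pred Carrier p → Group (c ⊔ ℓ ⊔ p) ℓ
  generatedSubgroup S = record
    { Carrier = Σ Carrier (Generated S)
    ; _≈_     = _≈_ on proj₁
    ; _∙_     = λ (x , x∈) (y , y∈) → x ∙ y , mult x∈ y∈
    ; ε       = ε , unit
    ; _⁻¹     = λ (x , x∈) → x ⁻¹ , inv x∈
    ; isGroup = record
      { isMonoid = record
        { isSemigroup = record
          { isMagma = record
            { isEquivalence = On.isEquivalence proj₁ (Group.isEquivalence G)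
            ; ∙-cong        = ∙-cong
            }
          ; assoc = λ (x , _) (y , _) (z , _) → assoc x y z
          }
        ; identity = (λ (x , _) → identityˡ x) , (λ (x , _) → identityʳ x)
        }
      ; inverse = (λ (x , _) → inverseˡ x) , (λ (x , _) → inverseʳ x)
      ; ⁻¹-cong = ⁻¹-cong
      }
    }

infix 4 _≅_

_≅_ : Group c ℓ → Group c′ ℓ′ → Set (c ⊔ ℓ ⊔ c′ ⊔ ℓ′)
G ≅ H = ∃ λ ⟦_⟧ → IsGroupIsomorphism ⟦_⟧
  where open GroupMorphisms (Group.rawGroup G) (Group.rawGroup H)

data V : Set where
  marked unmarked : V

cross : V → V
cross marked   = unmarked
cross unmarked = marked

cross-involutive : ∀ x → cross (cross x) ≡ x
cross-involutive marked   = refl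
cross-involutive unmarked = refl

V⁴ : Set
V⁴ = V × V × V × V

I J K : V⁴ → V⁴
I (a , b , c , d) = cross b , a , d , cross c
J (a , b , c , d) = cross c , cross d , a , b
K (a , b , c , d) = cross d , c , cross b , a

Iₚ Jₚ Kₚ : V⁴ ↔ V⁴
Iₚ = mk↔ₛ′ I (λ (a , b , c , d) → b , cross a , cross d , c)
  (λ (a , b , c , d) → cong₂ (λ a d → a , b , c , d) (cross-involutive a) (cross-involutive d))
  (λ (a , b , c , d) → cong₂ (λ b c → a , b , c , d) (cross-involutive b) (cross-involutive c))
Jₚ = mk↔ₛ′ J (λ (a , b , c , d) → c , d , cross a , cross b)
  (λ (a , b , c , d) → cong₂ (λ a b → a , b , c , d) (cross-involutive a) (cross-involutive b))
  (λ (a , b , c , d) → cong₂ (λ c d → a , b , c , d) (cross-involutive c) (cross-involutive d))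
Kₚ = mk↔ₛ′ K (λ (a , b , c , d) → d , cross c , b , cross a)
  (λ (a , b , c , d) → cong₂ (λ a c → a , b , c , d) (cross-involutive a) (cross-involutive c))
  (λ (a , b , c , d) → cong₂ (λ b d → a , b , c , d) (cross-involutive b) (cross-involutive d))

⟨I,J,K⟩ : Group 0ℓ 0ℓ
⟨I,J,K⟩ = generatedSubgroup (Sym V⁴) (_∈ (Iₚ ∷ Jₚ ∷ Kₚ ∷ []))

Basis : Set
Basis = Fin 4

pattern 𝟏 = zero
pattern 𝐢 = suc zero
pattern 𝐣 = suc (suc zero)
pattern 𝐤 = suc (suc (suc zero))

-- (s , u) stands for the signed unit s u.
Q : Set
Q = Sign × Basis

pattern +_ u = Sign.+ , u
pattern -_ u = Sign.- , u

infixl 7 _⊛_ _·_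

_⊛_ : Basis → Basis → Q
𝟏 ⊛ u = + u
u ⊛ 𝟏 = + u
𝐢 ⊛ 𝐢 = - 𝟏
𝐢 ⊛ 𝐣 = + 𝐤
𝐢 ⊛ 𝐤 = - 𝐣
𝐣 ⊛ 𝐢 = - 𝐤
𝐣 ⊛ 𝐣 = - 𝟏
𝐣 ⊛ 𝐤 = + 𝐢
𝐤 ⊛ 𝐢 = + 𝐣
𝐤 ⊛ 𝐣 = - 𝐢
𝐤 ⊛ 𝐤 = - 𝟏

sgn : Basis → Basis → Sign
sgn u v = proj₁ (u ⊛ v)

bas : Basis → Basis → Basis
bas u v = proj₂ (u ⊛ v)

_·_ : Q → Q → Q
(s , u) · (t , v) = s Sign.* t Sign.* sgn u v , bas u v

_⁻¹ : Q → Q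
(s , 𝟏)       ⁻¹ = s , 𝟏
(s , u@(suc _)) ⁻¹ = Sign.opposite s , u

i²≡-1 : + 𝐢 · + 𝐢 ≡ - 𝟏
i²≡-1 = refl

j²≡-1 : + 𝐣 · + 𝐣 ≡ - 𝟏
j²≡-1 = refl

k²≡-1 : + 𝐤 · + 𝐤 ≡ - 𝟏
k²≡-1 = refl

ijk≡-1 : (+ 𝐢 · + 𝐣) · + 𝐤 ≡ - 𝟏
ijk≡-1 = refl

cocycle : ∀ u v w →
  sgn u v Sign.* sgn (bas u v) w ≡ sgn v w Sign.* sgn u (bas v w) ×
  bas (bas u v) w ≡ bas u (bas v w)
cocycle = from-yes (all? λ u → all? λ v → all? λ w →
  (sgn u v Sign.* sgn (bas u v) w Sign.≟ sgn v w Sign.* sgn u (bas v w)) ×-dec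
  (bas (bas u v) w ≟ bas u (bas v w)))

·-assoc : ∀ x y z → (x · y) · z ≡ x · (y · z)
·-assoc (s , u) (t , v) (r , w) = cong₂ _,_ signs (proj₂ (cocycle u v w))
  where
  open ≡-Reasoning
  open Solver using (solve; _⊕_; _⊜_)
  α β γ δ : Sign
  α = sgn u v
  β = sgn (bas u v) w
  γ = sgn v w
  δ = sgn u (bas v w)
  signs : s Sign.* t Sign.* α Sign.* r Sign.* β ≡ s Sign.* (t Sign.* r Sign.* γ) Sign.* δ
  signs = begin
    s Sign.* t Sign.* α Sign.* r Sign.* β
      ≡⟨ solve 5 (λ s t α r β → (((s ⊕ t) ⊕ α) ⊕ r) ⊕ β ⊜ ((s ⊕ t) ⊕ r) ⊕ (α ⊕ β)) refl s t α r β ⟩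
    s Sign.* t Sign.* r Sign.* (α Sign.* β)
      ≡⟨ cong (s Sign.* t Sign.* r Sign.*_) (proj₁ (cocycle u v w)) ⟩
    s Sign.* t Sign.* r Sign.* (γ Sign.* δ)
      ≡⟨ solve 5 (λ s t r γ δ → ((s ⊕ t) ⊕ r) ⊕ (γ ⊕ δ) ⊜ (s ⊕ ((t ⊕ r) ⊕ γ)) ⊕ δ) refl s t r γ δ ⟩
    s Sign.* (t Sign.* r Sign.* γ) Sign.* δ ∎

·-identityˡ : ∀ x → (+ 𝟏) · x ≡ x
·-identityˡ (s , u) = cong (_, u) (Sign.*-identityʳ s)

·-identityʳ : ∀ x → x · (+ 𝟏) ≡ x
·-identityʳ (Sign.+ , 𝟏) = refl
·-identityʳ (Sign.+ , 𝐢) = refl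
·-identityʳ (Sign.+ , 𝐣) = refl
·-identityʳ (Sign.+ , 𝐤) = refl
·-identityʳ (Sign.- , 𝟏) = refl
·-identityʳ (Sign.- , 𝐢) = refl
·-identityʳ (Sign.- , 𝐣) = refl
·-identityʳ (Sign.- , 𝐤) = refl

·-inverseˡ : ∀ x → (x ⁻¹) · x ≡ + 𝟏
·-inverseˡ (Sign.+ , 𝟏) = refl
·-inverseˡ (Sign.+ , 𝐢) = refl
·-inverseˡ (Sign.+ , 𝐣) = refl
·-inverseˡ (Sign.+ , 𝐤) = refl
·-inverseˡ (Sign.- , 𝟏) = refl
·-inverseˡ (Sign.- , 𝐢) = refl
·-inverseˡ (Sign.- , 𝐣) = refl
·-inverseˡ (Sign.- , 𝐤) = refl

·-inverseʳ : ∀ x → x · (x ⁻¹) ≡ + 𝟏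
·-inverseʳ (Sign.+ , 𝟏) = refl
·-inverseʳ (Sign.+ , 𝐢) = refl
·-inverseʳ (Sign.+ , 𝐣) = refl
·-inverseʳ (Sign.+ , 𝐤) = refl
·-inverseʳ (Sign.- , 𝟏) = refl
·-inverseʳ (Sign.- , 𝐢) = refl
·-inverseʳ (Sign.- , 𝐣) = refl
·-inverseʳ (Sign.- , 𝐤) = refl

Q₈ : Group 0ℓ 0ℓ
Q₈ = record
  { Carrier = Q
  ; _≈_     = _≡_
  ; _∙_     = _·_
  ; ε       = + 𝟏
  ; _⁻¹     = _⁻¹
  ; isGroup = record
    { isMonoid = record
      { isSemigroup = record
        { isMagma = record
          { isEquivalence = isEquivalence
          ; ∙-cong        = cong₂ _·_
          }
        ; assoc = ·-assoc
        }
      ; identity = ·-identityˡ , ·-identityʳ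
      }
    ; inverse = ·-inverseˡ , ·-inverseʳ
    ; ⁻¹-cong = cong _⁻¹
    }
  }

{-# OPTIONS --safe #-}

-- Q₈ acts on V⁴ on the right: a sign acts by crossing all four entries, and i, j, k act by I, J, K.
-- Every permutation generated by I, J, K agrees with the action of some q ∈ Q₈.  This q is unique,
-- because it can be read off from the image of a single point (the action is free), and so
-- sending a generated permutation to its q is an isomorphism.

module Submission where

open import Defs
open import Algebra.Bundles using (Group)
open import Algebra.Morphism.Structures using (module GroupMorphisms)
open import Data.Fin.Base using (Fin; zero; suc)
open import Data.Fin.Properties using (*↔×)
open import Data.List.Base using ([]; _∷_)
open import Data.List.Membership.Propositional using (_∈_)
open import Data.List.Relation.Unary.Any using (here; there)
open import Data.Product.Base using (∃; _×_; _,_; proj₁)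
open import Data.Product.Function.NonDependent.Propositional using (_×-↔_)
open import Data.Sign.Base as Sign using (Sign)
open import Function.Bundles using (Bijection; Inverse; _↔_; mk↔ₛ′)
open import Function.Construct.Composition using (inverse)
open import Function.Properties.Bijection using (Bijection⇒Inverse)
open import Function.Properties.Inverse using (↔-refl; ↔-sym; ↔-trans)
open import Relation.Binary.PropositionalEquality
  using (_≡_; refl; sym; trans; cong; setoid; module ≡-Reasoning)

open Inverse using (to; from; strictlyInverseˡ)

crossAll : V⁴ → V⁴
crossAll (a , b , c , d) = cross a , cross b , cross c , cross d

crossAll-involutive : ∀ x → crossAll (crossAll x) ≡ x
crossAll-involutive (a , b , c , d)
  rewrite cross-involutive a | cross-involutive b | cross-involutive c | cross-involutive d = refl

signAct : Sign → V⁴ → V⁴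
signAct Sign.+ x = x
signAct Sign.- x = crossAll x

basisAct : Basis → V⁴ → V⁴
basisAct 𝟏 x = x
basisAct 𝐢 x = I x
basisAct 𝐣 x = J x
basisAct 𝐤 x = K x

act : Q → V⁴ → V⁴
act (s , u) x = signAct s (basisAct u x)

signAct-* : ∀ s t x → signAct (s Sign.* t) x ≡ signAct s (signAct t x)
signAct-* Sign.+ t      x = refl
signAct-* Sign.- Sign.+ x = refl
signAct-* Sign.- Sign.- x = sym (crossAll-involutive x)

signAct-comm : ∀ s t x → signAct s (signAct t x) ≡ signAct t (signAct s x)
signAct-comm Sign.+ t      x = refl
signAct-comm Sign.- Sign.+ x = refl
signAct-comm Sign.- Sign.- x = refl

-- This is the centrality of -1: `I`, `J` and `K` only permute entries and cross some of them, and
-- both commute with crossing everything.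
basisAct-signAct : ∀ u s x → basisAct u (signAct s x) ≡ signAct s (basisAct u x)
basisAct-signAct u Sign.+ x = refl
basisAct-signAct 𝟏 Sign.- x = refl
basisAct-signAct 𝐢 Sign.- x = refl
basisAct-signAct 𝐣 Sign.- x = refl
basisAct-signAct 𝐤 Sign.- x = refl

-- The multiplication table, checked against composites in which the left factor acts first. The
-- `rewrite`s cancel an entry crossed twice on one side only.
basisAct-⊛ : ∀ u v x → act (u ⊛ v) x ≡ basisAct v (basisAct u x)
basisAct-⊛ 𝟏 v x = refl
basisAct-⊛ 𝐢 𝟏 x = refl
basisAct-⊛ 𝐣 𝟏 x = refl
basisAct-⊛ 𝐤 𝟏 x = refl
basisAct-⊛ 𝐢 𝐢 x = refl
basisAct-⊛ 𝐢 𝐣 (a , b , c , d) rewrite cross-involutive c = refl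
basisAct-⊛ 𝐢 𝐤 (a , b , c , d) rewrite cross-involutive d = refl
basisAct-⊛ 𝐣 𝐢 (a , b , c , d) rewrite cross-involutive b = refl
basisAct-⊛ 𝐣 𝐣 x = refl
basisAct-⊛ 𝐣 𝐤 (a , b , c , d) rewrite cross-involutive d = refl
basisAct-⊛ 𝐤 𝐢 (a , b , c , d) rewrite cross-involutive b = refl
basisAct-⊛ 𝐤 𝐣 (a , b , c , d) rewrite cross-involutive c = refl
basisAct-⊛ 𝐤 𝐤 x = refl

-- Signs commute with each other and with the basis units, so they can be pulled out; `basisAct-⊛`
-- handles what remains.
act-· : ∀ q r x → act (q · r) x ≡ act r (act q x)
act-· (s , u) (t , v) x = begin
  signAct (s Sign.* t Sign.* sgn u v) (basisAct (bas u v) x)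
    ≡⟨ signAct-* (s Sign.* t) (sgn u v) _ ⟩
  signAct (s Sign.* t) (act (u ⊛ v) x)
    ≡⟨ cong (signAct (s Sign.* t)) (basisAct-⊛ u v x) ⟩
  signAct (s Sign.* t) (basisAct v (basisAct u x))
    ≡⟨ signAct-* s t _ ⟩
  signAct s (signAct t (basisAct v (basisAct u x)))
    ≡⟨ signAct-comm s t _ ⟩
  signAct t (signAct s (basisAct v (basisAct u x)))
    ≡⟨ cong (signAct t) (basisAct-signAct v s _) ⟨
  signAct t (basisAct v (signAct s (basisAct u x))) ∎
  where open ≡-Reasoning

-- Any point would do: -1 fixes none, and every unit other than 1 and -1 squares to -1, so all
-- stabilisers are trivial.
origin : V⁴
origin = marked , marked , marked , marked

-- On the orbit of the origin the last entry is determined by the other three.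
readOff : V⁴ → Q
readOff (marked   , marked   , marked   , _) = + 𝟏
readOff (unmarked , marked   , marked   , _) = + 𝐢
readOff (unmarked , unmarked , marked   , _) = + 𝐣
readOff (unmarked , marked   , unmarked , _) = + 𝐤
readOff (unmarked , unmarked , unmarked , _) = - 𝟏
readOff (marked   , unmarked , unmarked , _) = - 𝐢
readOff (marked   , marked   , unmarked , _) = - 𝐣
readOff (marked   , unmarked , marked   , _) = - 𝐤

readOff-act : ∀ q → readOff (act q origin) ≡ q
readOff-act (+ 𝟏) = refl
readOff-act (+ 𝐢) = refl
readOff-act (+ 𝐣) = refl
readOff-act (+ 𝐤) = refl
readOff-act (- 𝟏) = refl
readOff-act (- 𝐢) = refl
readOff-act (- 𝐣) = refl
readOff-act (- 𝐤) = refl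

act-faithful : ∀ q r → (∀ x → act q x ≡ act r x) → q ≡ r
act-faithful q r q≈r = begin
  q                       ≡⟨ readOff-act q ⟨
  readOff (act q origin)  ≡⟨ cong readOff (q≈r origin) ⟩
  readOff (act r origin)  ≡⟨ readOff-act r ⟩
  r                       ∎
  where open ≡-Reasoning

-- Acting by `q` and then `q ⁻¹` changes nothing at `from f x`; there the action of `q` is `to f`,
-- which leads back to `x`.
act-⁻¹ : ∀ (f : V⁴ ↔ V⁴) q → (∀ x → to f x ≡ act q x) → ∀ x → from f x ≡ act (q ⁻¹) x
act-⁻¹ f q f≈q x = begin
  from f x                         ≡⟨ cong (λ r → act r (from f x)) (·-inverseʳ q) ⟨
  act (q · q ⁻¹) (from f x)        ≡⟨ act-· q (q ⁻¹) (from f x) ⟩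
  act (q ⁻¹) (act q (from f x))    ≡⟨ cong (act (q ⁻¹)) (f≈q (from f x)) ⟨
  act (q ⁻¹) (to f (from f x))     ≡⟨ cong (act (q ⁻¹)) (strictlyInverseˡ f x) ⟩
  act (q ⁻¹) x                     ∎
  where open ≡-Reasoning

open Group ⟨I,J,K⟩ using (Carrier; _≈_; _∙_; ε)

-- Evaluates the word in the generators that the membership proof records. That the value depends on
-- the permutation alone is the content of `⟦⟧-cong`.
quaternion : ∀ {f} → Generated (Sym V⁴) (_∈ (Iₚ ∷ Jₚ ∷ Kₚ ∷ [])) f → Q
quaternion (gen (here _))                 = + 𝐢
quaternion (gen (there (here _)))         = + 𝐣
quaternion (gen (there (there (here _)))) = + 𝐤
quaternion unit                           = + 𝟏
quaternion (mult f∈ g∈)                   = quaternion f∈ · quaternion g∈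
quaternion (inv f∈)                       = quaternion f∈ ⁻¹
quaternion (resp _ f∈)                    = quaternion f∈

act-quaternion : ∀ {f} (f∈ : Generated (Sym V⁴) (_∈ (Iₚ ∷ Jₚ ∷ Kₚ ∷ [])) f) →
  ∀ x → to f x ≡ act (quaternion f∈) x
act-quaternion (gen (here refl))                 x = refl
act-quaternion (gen (there (here refl)))         x = refl
act-quaternion (gen (there (there (here refl)))) x = refl
act-quaternion unit                              x = refl
act-quaternion (mult {f} {g} f∈ g∈)              x = begin
  to g (to f x)                                ≡⟨ act-quaternion g∈ (to f x) ⟩
  act (quaternion g∈) (to f x)                 ≡⟨ cong (act (quaternion g∈)) (act-quaternion f∈ x) ⟩
  act (quaternion g∈) (act (quaternion f∈) x)  ≡⟨ act-· (quaternion f∈) (quaternion g∈) x ⟨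
  act (quaternion f∈ · quaternion g∈) x        ∎
  where open ≡-Reasoning
act-quaternion (inv {f} f∈)                      x = act-⁻¹ f (quaternion f∈) (act-quaternion f∈) x
act-quaternion (resp f≈g f∈)                     x = trans (sym (f≈g x)) (act-quaternion f∈ x)

⟦_⟧ : Carrier → Q
⟦ _ , f∈ ⟧ = quaternion f∈

act-⟦⟧ : ∀ f x → to (proj₁ f) x ≡ act ⟦ f ⟧ x
act-⟦⟧ (_ , f∈) = act-quaternion f∈

-- Equal permutations may carry different words, but the values of these words act identically, and
-- the action is faithful.
⟦⟧-cong : ∀ {f g} → f ≈ g → ⟦ f ⟧ ≡ ⟦ g ⟧
⟦⟧-cong {f} {g} f≈g = act-faithful ⟦ f ⟧ ⟦ g ⟧ λ x →
  trans (sym (act-⟦⟧ f x)) (trans (f≈g x) (act-⟦⟧ g x))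

⟦⟧-injective : ∀ {f g} → ⟦ f ⟧ ≡ ⟦ g ⟧ → f ≈ g
⟦⟧-injective {f} {g} f≡g x =
  trans (act-⟦⟧ f x) (trans (cong (λ q → act q x) f≡g) (sym (act-⟦⟧ g x)))

𝐢ᴳ 𝐣ᴳ 𝐤ᴳ : Carrier
𝐢ᴳ = Iₚ , gen (here refl)
𝐣ᴳ = Jₚ , gen (there (here refl))
𝐤ᴳ = Kₚ , gen (there (there (here refl)))

⟦⟧-surjective : ∀ q → ∃ λ f → ⟦ f ⟧ ≡ q
⟦⟧-surjective (+ 𝟏) = ε , refl
⟦⟧-surjective (+ 𝐢) = 𝐢ᴳ , refl
⟦⟧-surjective (+ 𝐣) = 𝐣ᴳ , refl
⟦⟧-surjective (+ 𝐤) = 𝐤ᴳ , refl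
-- Each negative unit is a product of two generators: ii = -1, kj = -i, ik = -j, ji = -k.
⟦⟧-surjective (- 𝟏) = 𝐢ᴳ ∙ 𝐢ᴳ , refl
⟦⟧-surjective (- 𝐢) = 𝐤ᴳ ∙ 𝐣ᴳ , refl
⟦⟧-surjective (- 𝐣) = 𝐢ᴳ ∙ 𝐤ᴳ , refl
⟦⟧-surjective (- 𝐤) = 𝐣ᴳ ∙ 𝐢ᴳ , refl

open GroupMorphisms (Group.rawGroup ⟨I,J,K⟩) (Group.rawGroup Q₈)

⟦⟧-isGroupIsomorphism : IsGroupIsomorphism ⟦_⟧
⟦⟧-isGroupIsomorphism = record
  { isGroupMonomorphism = record
    { isGroupHomomorphism = record
      { isMonoidHomomorphism = record
        { isMagmaHomomorphism = record
          { isRelHomomorphism = record { cong = λ {f} {g} → ⟦⟧-cong {f} {g} }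
          -- Evaluation of words respects products, unit and inverses by definition.
          ; homo = λ _ _ → refl
          }
        ; ε-homo = refl
        }
      ; ⁻¹-homo = λ _ → refl
      }
    ; injective = λ {f} {g} → ⟦⟧-injective {f} {g}
    }
  ; surjective = λ q → let f , f≡q = ⟦⟧-surjective q in
      f , λ {g} g≈f → trans (⟦⟧-cong {g} {f} g≈f) f≡q
  }

-- For the order of the group: elements are counted up to `≈`, since one permutation has many
-- membership proofs.
⟦⟧-bijection : Bijection (Group.setoid ⟨I,J,K⟩) (setoid Q)
⟦⟧-bijection = record
  { to        = ⟦_⟧
  ; cong      = λ {f} {g} → ⟦⟧-cong {f} {g}
  ; bijective = (λ {f} {g} → injective {f} {g}) , surjective
  }
  where open IsGroupIsomorphism ⟦⟧-isGroupIsomorphism using (injective; surjective)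

Sign↔Fin2 : Sign ↔ Fin 2
Sign↔Fin2 = mk↔ₛ′
  (λ { Sign.+ → zero ; Sign.- → suc zero })
  (λ { zero → Sign.+ ; (suc zero) → Sign.- })
  (λ { zero → refl ; (suc zero) → refl })
  (λ { Sign.+ → refl ; Sign.- → refl })

-- Two signs times four basis units; `2 * 4` computes to `8`.
Q↔Fin8 : Q ↔ Fin 8
Q↔Fin8 = ↔-trans (Sign↔Fin2 ×-↔ ↔-refl) (↔-sym *↔×)

theorem1 : Inverse (Group.setoid ⟨I,J,K⟩) (setoid (Fin 8)) × ⟨I,J,K⟩ ≅ Q₈
theorem1 = inverse (Bijection⇒Inverse ⟦⟧-bijection) Q↔Fin8 , ⟦_⟧ , ⟦⟧-isGroupIsomorphism
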